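{- Let $n$ be a positive integer, and let $x_i$ ($i=1,2,\dots,2n$) be indeterminates. Then $$\operatorname{Pf}_\lambda\bigl(x_i-x_j\bigr)_{1\le i<j\le 2n}=(1-\lambda)^{n-1}\prod_{i=1}^n(x_{2i-1}-x_{2i}).$$
   Context: $\lambda$ is an indeterminate. For an array $(A_{ij})_{1\le i<j\le 2n}$ (the strictly upper triangular part of a skew-symmetric matrix of size $2n$), the $\lambda$-Pfaffian is $$\operatorname{Pf}_\lambda(A_{ij})_{1\le i<j\le 2n}=\sum_{m\in\mathcal M([2n])}(-1)^{\mathrm{cross}(m)}\,\lambda^{\mathrm{cross}(m)+\mathrm{nest}(m)}\prod_{i=1}^n A_{m_{2i-1}m_{2i}}.$$ Here $\mathcal M([2n])$ is the set of perfect matchings of $[2n]=\{1,\dots,2n\}$, written $m=((m_1,m_2),\dots,(m_{2n-1},m_{2n}))$ with $m_{2i-1}<m_{2i}$ for all $i$ and $m_1<m_3<\cdots<m_{2n-1}$. $\mathrm{cross}(m)$ is the number of (unordered) pairs of pairs $(a,b),(c,d)$ in $m$ with $a<c<b<d$; $\mathrm{nest}(m)$ is the number of pairs of pairs $(a,b),(c,d)$ in $m$ with $a<c<d<b$. -}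

module Defs where

open import Algebra.Bundles using (CommutativeRing)
import Algebra.Definitions.RawMonoid as RawMonoidDefs
import Algebra.Properties.Semiring.Exp as Exp
open import Data.Fin.Base using (Fin; _<_)
open import Data.Fin.Properties using (_≟_; _<?_; all?)
open import Data.List.Base using (List; []; _∷_; length; map; filter; foldr; allFin; cartesianProduct; cartesianProductWith)
open import Data.Nat.Base using (ℕ; zero; suc; _+_; _*_)
open import Data.Product.Base using (_×_; _,_; proj₁; proj₂)
open import Data.Sum.Base using (_⊎_)
open import Data.Vec.Base using (Vec; []; _∷_; lookup; toList)
open import Data.Vec.Relation.Unary.All as All using (All)
open import Data.Vec.Relation.Unary.AllPairs as AllPairs using (AllPairs)
open import Data.Vec.Relation.Unary.Any as Any using (Any)
open import Relation.Binary.PropositionalEquality.Core using (_≡_)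
open import Relation.Nullary.Decidable using (Dec; map′; _×-dec_; _⊎-dec_; ¬?)
open import Relation.Nullary.Negation.Core using (¬_)

-- The vertex set {1,…,N} is Fin N, shifted to start at 0.
Edge : ℕ → Set
Edge N = Fin N × Fin N

_∈ₑ_ : ∀ {N} → Fin N → Edge N → Set
k ∈ₑ (a , b) = k ≡ a ⊎ k ≡ b

_∈ₑ?_ : ∀ {N} (k : Fin N) (e : Edge N) → Dec (k ∈ₑ e)
k ∈ₑ? (a , b) = (k ≟ a) ⊎-dec (k ≟ b)

Disjoint : ∀ {N} → Edge N → Edge N → Set
Disjoint e f = ∀ k → ¬ (k ∈ₑ e × k ∈ₑ f)

disjoint? : ∀ {N} (e f : Edge N) → Dec (Disjoint e f)
disjoint? e f = all? λ k → ¬? ((k ∈ₑ? e) ×-dec (k ∈ₑ? f))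

-- A perfect matching ((m₁,m₂),…,(m₂ₙ₋₁,m₂ₙ)) in its normal form:
-- m₂ᵢ₋₁ < m₂ᵢ and m₁ < m₃ < ⋯ < m₂ₙ₋₁.  The size is written n * 2 rather
-- than 2 * n because suc n * 2 reduces to 2 + n * 2.
record IsPerfectMatching {n : ℕ} (m : Vec (Edge (n * 2)) n) : Set where
  field
    ordered    : All (λ e → proj₁ e < proj₂ e) m
    increasing : AllPairs (λ e f → proj₁ e < proj₁ f) m
    disjoint   : AllPairs Disjoint m
    covering   : ∀ k → Any (k ∈ₑ_) m

isPerfectMatching? : ∀ {n} (m : Vec (Edge (n * 2)) n) → Dec (IsPerfectMatching m)
isPerfectMatching? m = map′
  (λ (o , i , d , c) → record { ordered = o ; increasing = i ; disjoint = d ; covering = c })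
  (λ p → let open IsPerfectMatching p in ordered , increasing , disjoint , covering)
  (All.all? (λ e → proj₁ e <? proj₂ e) m
    ×-dec AllPairs.allPairs? (λ e f → proj₁ e <? proj₁ f) m
    ×-dec AllPairs.allPairs? disjoint? m
    ×-dec all? (λ k → Any.any? (k ∈ₑ?_) m))

vectors : ∀ {A : Set} → List A → (n : ℕ) → List (Vec A n)
vectors xs zero    = [] ∷ []
vectors xs (suc n) = cartesianProductWith _∷_ xs (vectors xs n)

-- Every vector of n edges occurs exactly once in the list being filtered,
-- so this lists each perfect matching exactly once.
perfectMatchings : (n : ℕ) → List (Vec (Edge (n * 2)) n)
perfectMatchings n =
  filter isPerfectMatching?
    (vectors (cartesianProduct (allFin (n * 2)) (allFin (n * 2))) n)

Crossing : ∀ {N} → Edge N × Edge N → Set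
Crossing ((a , b) , (c , d)) = a < c × c < b × b < d

crossing? : ∀ {N} (p : Edge N × Edge N) → Dec (Crossing p)
crossing? ((a , b) , (c , d)) = (a <? c) ×-dec (c <? b) ×-dec (b <? d)

Nesting : ∀ {N} → Edge N × Edge N → Set
Nesting ((a , b) , (c , d)) = a < c × c < d × d < b

nesting? : ∀ {N} (p : Edge N × Edge N) → Dec (Nesting p)
nesting? ((a , b) , (c , d)) = (a <? c) ×-dec (c <? d) ×-dec (d <? b)

-- Counting over ordered pairs of edges counts unordered pairs: since a < c is
-- required, at most one of the two orders of a pair qualifies.
cross : ∀ {N n} → Vec (Edge N) n → ℕ
cross m = length (filter crossing? (cartesianProduct (toList m) (toList m)))

nest : ∀ {N n} → Vec (Edge N) n → ℕ
nest m = length (filter nesting? (cartesianProduct (toList m) (toList m)))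

module _ {c ℓ} (R : CommutativeRing c ℓ) where
  open CommutativeRing R using (Carrier; 0#; 1#; semiring; *-rawMonoid)
    renaming (_+_ to _+ᴿ_; _*_ to _*ᴿ_; -_ to -ᴿ_)
  open Exp semiring using (_^_)

  ∏ : ∀ {n} → (Fin n → Carrier) → Carrier
  ∏ = RawMonoidDefs.sum *-rawMonoid

  -- Only the entries A i j with i < j are ever used.
  Pf : Carrier → (n : ℕ) → (Fin (n * 2) → Fin (n * 2) → Carrier) → Carrier
  Pf q n A = foldr _+ᴿ_ 0# (map term (perfectMatchings n))
    where
    term : Vec (Edge (n * 2)) n → Carrier
    term m = ((-ᴿ 1#) ^ cross m) *ᴿ (q ^ (cross m + nest m))
      *ᴿ ∏ (λ i → let (a , b) = lookup m i in A a b)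

-- Scan the vertices from right to left, keeping the list P of closers that still
-- wait for their opener.  An edge from v to b ∈ P crosses the edges that end at
-- the members of P before b and lies inside those that end after b, so its sign
-- and its power of λ depend only on the place of b in P.  The weighted sum over
-- all completions is therefore a function of P given by a recursion.  Since
-- xᵢ − xⱼ is (up to sign) the determinant of (1, xᵢ) and (1, xⱼ), this function
-- factors through the exterior algebra of a free module of rank 2: it is zero
-- for three or more pending closers and a multiple β (x_a − x_b) for P = {a, b}.
-- Let α be its value at the empty P.  With no vertex left to scan, (α, β) = (1, 0).
-- With x₂ᵢ₋₁ and x₂ᵢ as further vertices to scan, α becomes (α + β)(x₂ᵢ₋₁ − x₂ᵢ) and
-- β becomes −λ times that, so α + β is multiplied by (1 − λ)(x₂ᵢ₋₁ − x₂ᵢ).  The value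
-- sought is the last α, hence one factor 1 − λ less than n.

module Submission where

open import Defs
open import Level using (Level; _⊔_)
open import Algebra.Bundles using (CommutativeMonoid; CommutativeRing)
import Algebra.Properties.CommutativeMonoid.Sum as Sum
open import Algebra.Properties.CommutativeSemigroup using (interchange)
import Algebra.Properties.Ring as RingProperties
open import Algebra.Properties.Semiring.Exp using (_^_)
import Algebra.Properties.Semiring.Exp as Exp
import Algebra.Solver.Ring.NaturalCoefficients.Default as Solver
open import Data.Fin.Base using (Fin; zero; suc; _<_; combine; opposite; toℕ)
open import Data.Fin.Patterns using (0F; 1F)
import Data.Fin.Permutation as Permutation
open import Data.Fin.Properties using (<-trans; <-irrefl; <-asym; _<?_; <⇒≢; combine-monoˡ-<;
  combine-surjective; opposite-prop; opposite-involutive; toℕ-combine; toℕ<n)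
open import Data.List.Base using (List; []; _∷_; [_]; _++_; map; concatMap; foldr; filter; length;
  reverse; tabulate; cartesianProduct)
open import Data.List.Membership.Propositional using (_∈_; _∉_; find; lose)
open import Data.List.Membership.Propositional.Properties
open import Data.List.Membership.Propositional.Properties.WithK using (unique∧set⇒bag)
open import Data.List.Properties using (filter-++; filter-all; filter-none; length-++; length-tabulate;
  unfold-reverse; reverse-involutive; reverse-injective; ∷-injectiveʳ; ++-identityʳ; map-∘)
open import Data.List.Relation.Binary.BagAndSetEquality using (∼bag⇒↭)
open import Data.List.Relation.Binary.Permutation.Propositional as ↭
  using (_↭_; prep; swap; ↭-refl; ↭-sym; ↭-trans; ↭-prep; ↭⇒↭ₛ)
open import Data.List.Relation.Binary.Permutation.Propositional.Properties
  using (shift; shifts; drop-∷; ↭-length; ↭-empty-inv; filter-↭; ∈-resp-↭; All-resp-↭; Any-resp-↭;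
    ↭-reverse; ++⁺; ++⁺ˡ) renaming (map⁺ to ↭-map⁺)
import Data.List.Relation.Binary.Permutation.Setoid.Properties as ↭ₛ
open import Data.List.Relation.Unary.All as All using (All; []; _∷_)
import Data.List.Relation.Unary.All.Properties as Allₚ
open import Data.List.Relation.Unary.AllPairs as AllPairs using (AllPairs; []; _∷_)
import Data.List.Relation.Unary.AllPairs.Properties as AllPairsₚ
open import Data.List.Relation.Unary.Any using (Any; here; there)
open import Data.List.Relation.Unary.Unique.Propositional using (Unique)
import Data.List.Relation.Unary.Unique.Propositional.Properties as Uniqueₚ
open import Data.Nat.Base as ℕ using (ℕ; zero; suc; NonZero; _∸_; _≤_; z≤n; s≤s)
  renaming (_+_ to _+ℕ_; _*_ to _*ℕ_)
import Data.Nat.Properties as ℕₚ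
open import Data.Nat.Solver using (module +-*-Solver)
open import Data.Product.Base using (∃; _×_; _,_; proj₁; proj₂; map₁)
open import Data.Sum.Base using (inj₁; inj₂)
open import Data.Vec.Base as Vec using (Vec; []; _∷_; toList; fromList; lookup)
import Data.Vec.Properties as Vecₚ
import Data.Vec.Relation.Unary.All.Properties as VecAllₚ
import Data.Vec.Relation.Unary.AllPairs as VecAllPairs
import Data.Vec.Relation.Unary.Any.Properties as VecAnyₚ
open import Function.Base using (_∘_; flip)
open import Function.Bundles using (mk⇔)
open import Relation.Binary.Core using (Rel)
open import Relation.Binary.PropositionalEquality as ≡ using (_≡_; _≢_)
open import Relation.Nullary using (¬_; yes; no; contradiction)
open import Relation.Nullary.Decidable using (_×-dec_)
open import Relation.Unary using (Pred; Decidable)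

private variable
  a p r : Level
  A B : Set a
  N : ℕ

-- Permutations and pairwise relations of lists

unique∧⊆⊇⇒↭ : {xs ys : List A} → Unique xs → Unique ys →
  (∀ {x} → x ∈ xs → x ∈ ys) → (∀ {x} → x ∈ ys → x ∈ xs) → xs ↭ ys
unique∧⊆⊇⇒↭ xs! ys! ⊆ ⊇ = ∼bag⇒↭ (unique∧set⇒bag xs! ys! (mk⇔ ⊆ ⊇))

AllPairs-reverse : {R : Rel A r} {xs : List A} → AllPairs R xs → AllPairs (flip R) (reverse xs)
AllPairs-reverse []                        = []
AllPairs-reverse {xs = x ∷ xs} (Rx ∷ Rxs)
  rewrite unfold-reverse x xs = AllPairsₚ.++⁺ (AllPairs-reverse Rxs) ([] ∷ [])
    (All.map (_∷ []) (All-resp-↭ (↭-sym (↭-reverse xs)) Rx))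

AllPairs-++⁻ : {R : Rel A r} (xs : List A) {ys : List A} → AllPairs R (xs ++ ys) →
  AllPairs R xs × AllPairs R ys × All (λ x → All (R x) ys) xs
AllPairs-++⁻ []       Rys        = [] , Rys , []
AllPairs-++⁻ (x ∷ xs) (Rx ∷ Rxs) =
  let Rxs′ , Rys , Rxsys = AllPairs-++⁻ xs Rxs
  in Allₚ.++⁻ˡ xs Rx ∷ Rxs′ , Rys , Allₚ.++⁻ʳ xs Rx ∷ Rxsys

-- Completions and the invariant of the scan

Split : Set a → Set a
Split A = List A × A × List A

picked : Split A → A
picked (_ , b , _) = b

unpicked : Split A → List A
unpicked (pre , _ , suf) = pre ++ suf

-- The parts before and after the picked closer are kept apart because their lengths become the
-- numbers of crossings and nestings that the new edge adds.
splits : List A → List (Split A)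
splits []       = []
splits (x ∷ xs) = ([] , x , xs) ∷ map (map₁ (x ∷_)) (splits xs)

∈-splits⁺ : ∀ (pre : List A) {b suf} → (pre , b , suf) ∈ splits (pre ++ b ∷ suf)
∈-splits⁺ []        = here ≡.refl
∈-splits⁺ (x ∷ pre) = there (∈-map⁺ (map₁ (x ∷_)) (∈-splits⁺ pre))

∈-splits⁻ : ∀ {xs pre suf : List A} {b} → (pre , b , suf) ∈ splits xs → xs ≡ pre ++ b ∷ suf
∈-splits⁻ {xs = _ ∷ _} (here ≡.refl) = ≡.refl
∈-splits⁻ {xs = x ∷ _} (there s)
  with _ , s′ , ≡.refl ← ∈-map⁻ (map₁ (x ∷_)) s = ≡.cong (x ∷_) (∈-splits⁻ s′)

splits-unique : {xs : List A} → Unique xs → AllPairs (λ s t → picked s ≢ picked t) (splits xs)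
splits-unique []         = []
splits-unique {xs = x ∷ xs} (x∉ ∷ xs!) =
  Allₚ.map⁺ (All.tabulate λ {s} s∈ → All.lookup x∉
    (≡.subst (picked s ∈_) (≡.sym (∈-splits⁻ s∈)) (∈-++⁺ʳ (proj₁ s) (here ≡.refl))))
  ∷ AllPairsₚ.map⁺ (splits-unique xs!)

-- L holds the vertices still to be scanned, the largest first, and P the pending
-- closers, the smallest first.
completions : List A → List A → List (List (A × A))
completions []      []      = [ [] ]
completions []      (_ ∷ _) = []
completions (v ∷ L) P       = completions L (v ∷ P) ++
  concatMap (λ s → map ((v , picked s) ∷_) (completions L (unpicked s))) (splits P)

vertices : List (A × A) → List A
vertices = concatMap λ (a , b) → a ∷ b ∷ []

length-vertices : (es : List (A × A)) → length (vertices es) ≡ length es *ℕ 2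
length-vertices []       = ≡.refl
length-vertices (_ ∷ es) = ≡.cong (2 +ℕ_) (length-vertices es)

-- The state of the scan. Since P is increasing and lies above all of L, the place of a closer in P
-- tells which pending closers lie inside and which lie beyond a new edge.
record Scan {N} (L P : List (Fin N)) : Set where
  constructor mkScan
  field
    remaining-↓       : AllPairs (flip _<_) L
    pending-↑         : AllPairs _<_ P
    remaining<pending : All (λ u → All (u <_) P) L

Scan-pend : ∀ {v : Fin N} {L P} → Scan (v ∷ L) P → Scan L (v ∷ P)
Scan-pend (mkScan (L<v ∷ L↓) P↑ (v<P ∷ L<P)) =
  mkScan L↓ (v<P ∷ P↑) (All.zipWith (λ (u<v , u<P) → u<v ∷ u<P) (L<v , L<P))

Scan-unpick : ∀ {v b : Fin N} {L} pre {suf} → Scan (v ∷ L) (pre ++ b ∷ suf) → Scan L (pre ++ suf)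
Scan-unpick pre (mkScan (_ ∷ L↓) P↑ (_ ∷ L<P)) with AllPairs-++⁻ pre P↑
... | pre↑ , _ ∷ suf↑ , pre<suf =
  mkScan L↓ (AllPairsₚ.++⁺ pre↑ suf↑ (All.map All.tail pre<suf))
    (All.map (λ u<P → Allₚ.++⁺ (Allₚ.++⁻ˡ pre u<P) (All.tail (Allₚ.++⁻ʳ pre u<P))) L<P)

Scan-unique : ∀ {L P : List (Fin N)} → Scan L P → Unique P
Scan-unique (mkScan _ P↑ _) = AllPairs.map <⇒≢ P↑

Scan-head∉ : ∀ {v : Fin N} {L P} → Scan (v ∷ L) P → v ∉ L
Scan-head∉ (mkScan (L<v ∷ _) _ _) v∈L = <-irrefl ≡.refl (All.lookup L<v v∈L)

-- Edges come in decreasing order of their openers, the order in which the scan meets them.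
-- `matched` expresses in one permutation that the edges are disjoint and that they cover exactly L
-- and P; `openers` leaves the members of P only the role of closers.
record IsCompletion {N} (L P : List (Fin N)) (es : List (Edge N)) : Set where
  field
    ordered    : All (λ e → proj₁ e < proj₂ e) es
    decreasing : AllPairs (λ e f → proj₁ f < proj₁ e) es
    openers    : All (λ e → proj₁ e ∈ L) es
    matched    : vertices es ↭ L ++ P

-- Soundness, completeness and uniqueness of the enumeration

completions-sound : ∀ {L P : List (Fin N)} {es} → Scan L P → es ∈ completions L P → IsCompletion L P es
completions-sound {L = []} {[]} sc (here ≡.refl) =
  record { ordered = [] ; decreasing = [] ; openers = [] ; matched = ↭-refl }
completions-sound {L = v ∷ L} {P} sc es∈ with ∈-++⁻ (completions L (v ∷ P)) es∈
... | inj₁ es∈ˡ = record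
  { ordered = ordered ; decreasing = decreasing
  ; openers = All.map there openers
  ; matched = ↭-trans matched (shift v L P) }
  where open IsCompletion (completions-sound (Scan-pend sc) es∈ˡ)
... | inj₂ es∈ʳ
  with (pre , b , suf) , s∈ , es∈ₛ ← find (∈-concatMap⁻ _ {splits P} es∈ʳ)
  with es′ , es′∈ , ≡.refl ← ∈-map⁻ ((v , b) ∷_) es∈ₛ
  with ≡.refl ← ∈-splits⁻ s∈
  with mkScan (L<v ∷ _) _ (v<P ∷ _) ← sc = record
  { ordered = All.lookup v<P (∈-++⁺ʳ pre (here ≡.refl)) ∷ ordered
  ; decreasing = All.map (All.lookup L<v) openers ∷ decreasing
  ; openers = here ≡.refl ∷ All.map there openers
  ; matched = ↭-prep v (↭-trans (↭-prep b matched) (↭-trans (↭-sym (shift b L (pre ++ suf)))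
      (++⁺ˡ L (↭-sym (shift b pre suf))))) }
  where open IsCompletion (completions-sound (Scan-unpick pre sc) es′∈)

-- The first edge (a , b) has the largest opener. If a is v, then b exceeds v, so b is not in L and
-- must be pending. If a lies in L, then all openers are below v, so v is a closer and joins the
-- pending ones.
completions-complete : ∀ {L P : List (Fin N)} {es} → Scan L P → IsCompletion L P es → es ∈ completions L P
completions-complete {L = []} {P} {es = []} sc c
  with ≡.refl ← ↭-empty-inv (↭-sym (IsCompletion.matched c)) = here ≡.refl
completions-complete {L = []} {es = _ ∷ _} sc c with () ∷ _ ← IsCompletion.openers c
completions-complete {L = v ∷ L} {es = []} sc c with () ← ↭-length (IsCompletion.matched c)
completions-complete {L = v ∷ L} {P} {es = (a , b) ∷ es} sc c
  with record { ordered = a<b ∷ ordered ; decreasing = es<a ∷ decreasing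
              ; openers = a∈ ∷ openers ; matched = matched } ← c
  with mkScan (L<v ∷ _) _ _ ← sc
  with a∈
... | here ≡.refl = ∈-++⁺ʳ (completions L (v ∷ P)) (pick b∈P)
  where
  below : ∀ {u} → u < v → u ∈ v ∷ L → u ∈ L
  below u<v (here ≡.refl) = contradiction u<v (<-irrefl ≡.refl)
  below u<v (there u∈L) = u∈L
  b∈L++P : b ∈ L ++ P
  b∈L++P = ∈-resp-↭ (drop-∷ matched) (here ≡.refl)
  b∈P : b ∈ P
  b∈P with ∈-++⁻ L b∈L++P
  ... | inj₁ b∈L = contradiction (All.lookup L<v b∈L) (<-asym a<b)
  ... | inj₂ b∈  = b∈
  pick : b ∈ P → ((v , b) ∷ es) ∈ concatMap _ (splits P)
  pick b∈P with pre , suf , ≡.refl ← ∈-∃++ b∈P =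
    ∈-concatMap⁺ _ (lose (∈-splits⁺ pre) (∈-map⁺ _ (completions-complete (Scan-unpick pre sc) record
      { ordered = ordered ; decreasing = decreasing
      ; openers = All.zipWith (λ (u<v , u∈) → below u<v u∈) (es<a , openers)
      ; matched = drop-∷ (↭-trans (drop-∷ matched)
          (↭-trans (++⁺ˡ L (shift b pre suf)) (shift b L (pre ++ suf))))
      })))
... | there a∈L = ∈-++⁺ˡ (completions-complete (Scan-pend sc) record
  { ordered = a<b ∷ ordered ; decreasing = es<a ∷ decreasing
  ; openers = a∈L ∷ All.zipWith (λ (u<a , u∈) → below u<a u∈) (es<a , openers)
  ; matched = ↭-trans matched (↭-sym (shift v L P)) })
  where
  below : ∀ {u} → u < a → u ∈ v ∷ L → u ∈ L
  below v<a (here ≡.refl) = contradiction v<a (<-asym (All.lookup L<v a∈L))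
  below u<a (there u∈L) = u∈L

-- The branches are told apart by the role of v: in the first it opens no edge, and in the others it
-- opens an edge whose closer differs from branch to branch.
completions-unique : ∀ {L P : List (Fin N)} → Scan L P → Unique (completions L P)
completions-unique {L = []} {[]}    sc = [] ∷ []
completions-unique {L = []} {_ ∷ _} sc = []
completions-unique {L = v ∷ L} {P} sc = Uniqueₚ.++⁺ (completions-unique (Scan-pend sc))
  (Uniqueₚ.concat⁺
    (Allₚ.map⁺ (All.tabulate unique-branch))
    (AllPairsₚ.map⁺ (AllPairs.map (λ {s} {t} → disjoint-branches {s} {t})
      (splits-unique (Scan-unique sc)))))
  λ (∈ˡ , ∈ʳ) → v-opens ∈ʳ ∈ˡ
  where
  unique-branch : ∀ {s} → s ∈ splits P → Unique (map ((v , picked s) ∷_) (completions L (unpicked s)))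
  unique-branch {pre , b , suf} s∈ with ≡.refl ← ∈-splits⁻ s∈ =
    Uniqueₚ.map⁺ ∷-injectiveʳ (completions-unique (Scan-unpick pre sc))
  disjoint-branches : ∀ {s t : Split _} → picked s ≢ picked t → ∀ {es} →
    ¬ (es ∈ map ((v , picked s) ∷_) (completions L (unpicked s)) ×
       es ∈ map ((v , picked t) ∷_) (completions L (unpicked t)))
  disjoint-branches s≢t (∈ₛ , ∈ₜ)
    with _ , _ , ≡.refl ← ∈-map⁻ _ ∈ₛ
    with _ , _ , ≡.refl ← ∈-map⁻ _ ∈ₜ = s≢t ≡.refl
  v-opens : ∀ {es} → es ∈ concatMap (λ s → map ((v , picked s) ∷_) (completions L (unpicked s))) (splits P) →
    es ∉ completions L (v ∷ P)
  v-opens ∈ʳ ∈ˡ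
    with s , _ , es∈ₛ ← find (∈-concatMap⁻ _ {splits P} ∈ʳ)
    with _ , _ , ≡.refl ← ∈-map⁻ _ es∈ₛ
    with v∈L ∷ _ ← IsCompletion.openers (completions-sound (Scan-pend sc) ∈ˡ) = Scan-head∉ sc v∈L

-- Perfect matchings as completions of the full vertex list

∈-vertices⁺ : ∀ {k : Fin N} {es} → Any (k ∈ₑ_) es → k ∈ vertices es
∈-vertices⁺ (here (inj₁ k≡a)) = here k≡a
∈-vertices⁺ (here (inj₂ k≡b)) = there (here k≡b)
∈-vertices⁺ (there k∈)        = there (there (∈-vertices⁺ k∈))

∈-vertices⁻ : ∀ {k : Fin N} es → k ∈ vertices es → Any (k ∈ₑ_) es
∈-vertices⁻ (_ ∷ es) (here k≡a)         = here (inj₁ k≡a)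
∈-vertices⁻ (_ ∷ es) (there (here k≡b)) = here (inj₂ k≡b)
∈-vertices⁻ (_ ∷ es) (there (there k∈)) = there (∈-vertices⁻ es k∈)

vertices-unique⁺ : {es : List (Edge N)} → All (λ e → proj₁ e < proj₂ e) es → AllPairs Disjoint es →
  Unique (vertices es)
vertices-unique⁺ []        []        = []
vertices-unique⁺ {es = (a , b) ∷ es} (a<b ∷ <es) (#es ∷ es#) =
  (<⇒≢ a<b ∷ fresh (inj₁ ≡.refl)) ∷ fresh (inj₂ ≡.refl) ∷ vertices-unique⁺ <es es#
  where
  fresh : ∀ {k} → k ∈ₑ (a , b) → All (k ≢_) (vertices es)
  fresh k∈e = All.tabulate λ { k∈es ≡.refl →
    let _ , f∈es , k∈f = find (∈-vertices⁻ es k∈es) in All.lookup #es f∈es _ (k∈e , k∈f) }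

vertices-unique⁻ : (es : List (Edge N)) → Unique (vertices es) → AllPairs Disjoint es
vertices-unique⁻ []       []               = []
vertices-unique⁻ ((a , b) ∷ es) ((_ ∷ a∉) ∷ b∉ ∷ es!) = All.tabulate disjoint ∷ vertices-unique⁻ es es!
  where
  disjoint : ∀ {f} → f ∈ es → Disjoint (a , b) f
  disjoint f∈ k (inj₁ ≡.refl , k∈f) = All.lookup a∉ (∈-vertices⁺ (lose f∈ k∈f)) ≡.refl
  disjoint f∈ k (inj₂ ≡.refl , k∈f) = All.lookup b∉ (∈-vertices⁺ (lose f∈ k∈f)) ≡.refl

Disjoint-sym : {e f : Edge N} → Disjoint e f → Disjoint f e
Disjoint-sym e#f k (k∈f , k∈e) = e#f k (k∈e , k∈f)

AllPairs-toList⁺ : ∀ {R : Rel A r} {n} {xs : Vec A n} → VecAllPairs.AllPairs R xs → AllPairs R (toList xs)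
AllPairs-toList⁺ VecAllPairs.[]         = []
AllPairs-toList⁺ (Rx VecAllPairs.∷ Rxs) = VecAllₚ.toList⁺ Rx ∷ AllPairs-toList⁺ Rxs

AllPairs-toList⁻ : ∀ {R : Rel A r} {n} {xs : Vec A n} → AllPairs R (toList xs) → VecAllPairs.AllPairs R xs
AllPairs-toList⁻ {xs = []}    []         = VecAllPairs.[]
AllPairs-toList⁻ {xs = _ ∷ _} (Rx ∷ Rxs) = VecAllₚ.toList⁻ Rx VecAllPairs.∷ AllPairs-toList⁻ Rxs

∈-vectors : ∀ {A : Set} {xs : List A} → (∀ x → x ∈ xs) → ∀ {n} (v : Vec A n) → v ∈ vectors xs n
∈-vectors x∈ []      = here ≡.refl
∈-vectors x∈ (x ∷ v) = ∈-cartesianProductWith⁺ _∷_ (x∈ x) (∈-vectors x∈ v)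

vectors-unique : ∀ {A : Set} {xs : List A} → Unique xs → ∀ n → Unique (vectors xs n)
vectors-unique xs! zero    = [] ∷ []
vectors-unique xs! (suc n) = Uniqueₚ.cartesianProductWith⁺ _∷_ Vecₚ.∷-injective xs! (vectors-unique xs! n)

-- Mediates between the normal form of a matching, with increasing openers, and the scan, which
-- yields the largest opener first.
toDecreasing : ∀ {n} → Vec A n → List A
toDecreasing = reverse ∘ toList

toDecreasing-injective : ∀ {n} {v w : Vec A n} → toDecreasing v ≡ toDecreasing w → v ≡ w
toDecreasing-injective {v = v} {w} eq =
  ≡.trans (≡.sym (Vecₚ.cast-is-id ≡.refl v)) (Vecₚ.toList-injective ≡.refl v w (reverse-injective eq))

toDecreasing-surjective : ∀ {n} (xs : List A) → length xs ≡ n → ∃ λ (v : Vec A n) → xs ≡ toDecreasing v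
toDecreasing-surjective xs ≡.refl = Vec.reverse (fromList xs) ,
  (begin
    xs                                       ≡⟨ reverse-involutive xs ⟨
    reverse (reverse xs)                     ≡⟨ ≡.cong (reverse ∘ reverse) (Vecₚ.toList∘fromList xs) ⟨
    reverse (reverse (toList (fromList xs))) ≡⟨ ≡.cong reverse (Vecₚ.toList-reverse (fromList xs)) ⟨
    toDecreasing (Vec.reverse (fromList xs)) ∎)
  where open ≡.≡-Reasoning

module _ {n} {L : List (Fin (n *ℕ 2))} (L↓ : AllPairs (flip _<_) L) (k∈L : ∀ k → k ∈ L) where

  private
    L! : Unique (L ++ [])
    L! = ≡.subst Unique (≡.sym (++-identityʳ L)) (AllPairs.map (λ y<x x≡y → <⇒≢ y<x (≡.sym x≡y)) L↓)

  isPerfectMatching⇒isCompletion : (m : Vec (Edge (n *ℕ 2)) n) → IsPerfectMatching m →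
    IsCompletion L [] (toDecreasing m)
  isPerfectMatching⇒isCompletion m pm = record
    { ordered    = ordered′
    ; decreasing = AllPairs-reverse (AllPairs-toList⁺ increasing)
    ; openers    = All.tabulate λ _ → k∈L _
    ; matched    = unique∧⊆⊇⇒↭
        (vertices-unique⁺ ordered′
          (AllPairs.map Disjoint-sym (AllPairs-reverse (AllPairs-toList⁺ disjoint))))
        L!
        (λ _ → ∈-++⁺ˡ (k∈L _))
        (λ _ → ∈-vertices⁺ (Any-resp-↭ (↭-sym (↭-reverse (toList m))) (VecAnyₚ.toList⁺ (covering _))))
    }
    where
    open IsPerfectMatching pm
    ordered′ : All (λ e → proj₁ e < proj₂ e) (toDecreasing m)
    ordered′ = All-resp-↭ (↭-sym (↭-reverse (toList m))) (VecAllₚ.toList⁺ ordered)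

  isCompletion⇒isPerfectMatching : (m : Vec (Edge (n *ℕ 2)) n) → IsCompletion L [] (toDecreasing m) →
    IsPerfectMatching m
  isCompletion⇒isPerfectMatching m c = record
    { ordered    = VecAllₚ.toList⁻ (All-resp-↭ (↭-reverse (toList m)) ordered)
    ; increasing = AllPairs-toList⁻ (unreverse (AllPairs-reverse decreasing))
    ; disjoint   = AllPairs-toList⁻ (unreverse (AllPairs.map Disjoint-sym (AllPairs-reverse
        (vertices-unique⁻ (toDecreasing m)
          (↭ₛ.Unique-resp-↭ (≡.setoid _) (↭⇒↭ₛ (↭-sym matched)) L!)))))
    ; covering   = λ k → VecAnyₚ.toList⁻ (Any-resp-↭ (↭-reverse (toList m))
        (∈-vertices⁻ (toDecreasing m) (∈-resp-↭ (↭-sym matched) (∈-++⁺ˡ (k∈L k)))))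
    }
    where
    open IsCompletion c
    unreverse : {R : Rel (Edge (n *ℕ 2)) r} → AllPairs R (reverse (toDecreasing m)) → AllPairs R (toList m)
    unreverse = ≡.subst (AllPairs _) (reverse-involutive (toList m))

  -- Neither list has repetitions, so it suffices to compare their members. The length of L enters
  -- through `size`: a completion is a list of unspecified length, and counting its vertices shows
  -- that it has n edges and so comes from a vector.
  perfectMatchings-↭ : length L ≡ n *ℕ 2 → map toDecreasing (perfectMatchings n) ↭ completions L []
  perfectMatchings-↭ |L|≡2n = unique∧⊆⊇⇒↭
    (Uniqueₚ.map⁺ toDecreasing-injective (Uniqueₚ.filter⁺ isPerfectMatching?
      (vectors-unique (Uniqueₚ.cartesianProduct⁺ (Uniqueₚ.allFin⁺ _) (Uniqueₚ.allFin⁺ _)) n)))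
    (completions-unique scan)
    to from
    where
    scan : Scan L []
    scan = mkScan L↓ [] (All.tabulate λ _ → [])
    to : ∀ {es} → es ∈ map toDecreasing (perfectMatchings n) → es ∈ completions L []
    to es∈ with m , m∈ , ≡.refl ← ∈-map⁻ toDecreasing es∈ =
      completions-complete scan (isPerfectMatching⇒isCompletion m
        (∈-filter⁻ isPerfectMatching? {xs = vectors _ n} m∈ .proj₂))
    size : ∀ {es} → IsCompletion L [] es → length es ≡ n
    size {es} c = ℕₚ.*-cancelʳ-≡ _ _ 2 (begin
      length es *ℕ 2       ≡⟨ length-vertices es ⟨
      length (vertices es) ≡⟨ ↭-length (IsCompletion.matched c) ⟩
      length (L ++ [])     ≡⟨ ≡.cong length (++-identityʳ L) ⟩
      length L             ≡⟨ |L|≡2n ⟩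
      n *ℕ 2               ∎)
      where open ≡.≡-Reasoning
    from : ∀ {es} → es ∈ completions L [] → es ∈ map toDecreasing (perfectMatchings n)
    from {es} es∈
      with c ← completions-sound scan es∈
      with m , ≡.refl ← toDecreasing-surjective es (size c) =
      ∈-map⁺ toDecreasing (∈-filter⁺ isPerfectMatching?
        (∈-vectors (λ (a , b) → ∈-cartesianProduct⁺ (∈-allFin a) (∈-allFin b)) m)
        (isCompletion⇒isPerfectMatching m c))

-- Counting in lists of pairs

cartesianProduct-↭ : {xs xs′ : List A} {ys ys′ : List B} → xs ↭ xs′ → ys ↭ ys′ →
  cartesianProduct xs ys ↭ cartesianProduct xs′ ys′
cartesianProduct-↭ {xs′ = xs′} {ys} {ys′} xs↭ ys↭ = ↭-trans (left xs↭) (right xs′)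
  where
  left : ∀ {xs xs′} → xs ↭ xs′ → cartesianProduct xs ys ↭ cartesianProduct xs′ ys
  left ↭.refl        = ↭.refl
  left (prep x p)    = ++⁺ˡ (map (x ,_) ys) (left p)
  left (swap x y p)  = ↭-trans (shifts (map (x ,_) ys) (map (y ,_) ys))
    (++⁺ˡ (map (y ,_) ys) (++⁺ˡ (map (x ,_) ys) (left p)))
  left (↭.trans p q) = ↭-trans (left p) (left q)
  right : ∀ xs → cartesianProduct xs ys ↭ cartesianProduct xs ys′
  right []       = ↭.refl
  right (x ∷ xs) = ++⁺ (↭-map⁺ (x ,_) ys↭) (right xs)

count : {P : Pred A p} → Decidable P → List A → ℕ
count P? xs = length (filter P? xs)

module _ {P : Pred A p} (P? : Decidable P) where

  count-++ : ∀ xs ys → count P? (xs ++ ys) ≡ count P? xs +ℕ count P? ys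
  count-++ xs ys = ≡.trans (≡.cong length (filter-++ P? xs ys)) (length-++ (filter P? xs))

  count-all : ∀ {xs} → All P xs → count P? xs ≡ length xs
  count-all Pxs = ≡.cong length (filter-all P? Pxs)

  count-none : ∀ {xs} → All (¬_ ∘ P) xs → count P? xs ≡ 0
  count-none ¬Pxs = ≡.cong length (filter-none P? ¬Pxs)

  count-map : ∀ (f : B → A) xs → count P? (map f xs) ≡ count (P? ∘ f) xs
  count-map f []       = ≡.refl
  count-map f (x ∷ xs) with P? (f x)
  ... | yes _ = ≡.cong suc (count-map f xs)
  ... | no  _ = count-map f xs

  count-∷ : ∀ x xs → count P? (x ∷ xs) ≡ count P? [ x ] +ℕ count P? xs
  count-∷ x xs = count-++ [ x ] xs

  count-↭ : ∀ {xs ys} → xs ↭ ys → count P? xs ≡ count P? ys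
  count-↭ xs↭ys = ↭-length (filter-↭ P? xs↭ys)

module _ {R : Pred (A × A) p} (R? : Decidable R) where

  count-productʳ : ∀ xs y ys → count R? (cartesianProduct xs (y ∷ ys)) ≡
    count (R? ∘ (_, y)) xs +ℕ count R? (cartesianProduct xs ys)
  count-productʳ []       y ys = ≡.refl
  count-productʳ (x ∷ xs) y ys = begin
    count R? ((x , y) ∷ map (x ,_) ys ++ cartesianProduct xs (y ∷ ys))
      ≡⟨ count-∷ R? (x , y) _ ⟩
    count R? [ (x , y) ] +ℕ count R? (map (x ,_) ys ++ cartesianProduct xs (y ∷ ys))
      ≡⟨ ≡.cong₂ _+ℕ_ (count-map R? (_, y) [ x ])
           (≡.trans (count-++ R? (map (x ,_) ys) _)
             (≡.cong (count R? (map (x ,_) ys) +ℕ_) (count-productʳ xs y ys))) ⟩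
    cx +ℕ (cm +ℕ (c +ℕ cp))
      ≡⟨ solve 4 (λ cx cm c cp → cx :+ (cm :+ (c :+ cp)) := (cx :+ c) :+ (cm :+ cp)) ≡.refl cx cm c cp ⟩
    (cx +ℕ c) +ℕ (cm +ℕ cp)
      ≡⟨ ≡.cong₂ _+ℕ_ (≡.sym (count-∷ (R? ∘ (_, y)) x xs)) (≡.sym (count-++ R? (map (x ,_) ys) _)) ⟩
    count (R? ∘ (_, y)) (x ∷ xs) +ℕ count R? (map (x ,_) ys ++ cartesianProduct xs ys) ∎
    where
    open ≡.≡-Reasoning
    open +-*-Solver
    cx = count (R? ∘ (_, y)) [ x ]
    cm = count R? (map (x ,_) ys)
    c  = count (R? ∘ (_, y)) xs
    cp = count R? (cartesianProduct xs ys)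

  -- The hypothesis empties the row of x, diagonal included, so only its column is left. For
  -- crossings and nestings it holds when x is the edge with the largest opener, since both
  -- relations ask the first edge to open first.
  count-product-∷ : ∀ {x xs} → All (λ y → ¬ R (x , y)) (x ∷ xs) →
    count R? (cartesianProduct (x ∷ xs) (x ∷ xs)) ≡ count (R? ∘ (_, x)) xs +ℕ count R? (cartesianProduct xs xs)
  count-product-∷ {x} {xs} ¬Rx = begin
    count R? (map (x ,_) (x ∷ xs) ++ cartesianProduct xs (x ∷ xs))
      ≡⟨ count-++ R? (map (x ,_) (x ∷ xs)) _ ⟩
    count R? (map (x ,_) (x ∷ xs)) +ℕ count R? (cartesianProduct xs (x ∷ xs))
      ≡⟨ ≡.cong₂ _+ℕ_ (count-none R? (Allₚ.map⁺ ¬Rx)) (count-productʳ xs x xs) ⟩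
    count (R? ∘ (_, x)) xs +ℕ count R? (cartesianProduct xs xs) ∎
    where open ≡.≡-Reasoning

-- Replaces a count of edges by a count of vertices. No opener satisfies Q, so each edge contributes
-- through its closer alone. The new count needs only the collection of vertices, which `matched`
-- supplies, and not how they are paired.
count-vertices : {R : Pred (A × A) p} (R? : Decidable R) {Q : Pred A r} (Q? : Decidable Q)
  {es : List (A × A)} → All (λ (a , b) → ¬ Q a × (R (a , b) → Q b) × (Q b → R (a , b))) es →
  count R? es ≡ count Q? (vertices es)
count-vertices R? Q? [] = ≡.refl
count-vertices R? Q? {(a , b) ∷ es} ((¬Qa , R⇒Q , Q⇒R) ∷ h) with Q? a
... | yes Qa = contradiction Qa ¬Qa
... | no _ with R? (a , b) | Q? b
...   | yes _ | yes _ = ≡.cong suc (count-vertices R? Q? h)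
...   | no _  | no _  = count-vertices R? Q? h
...   | yes r | no ¬q = contradiction (R⇒Q r) ¬q
...   | no ¬r | yes q = contradiction (Q⇒R q) ¬r

-- Crossings and nestings of an added edge

module _ {N : ℕ} where
  crossings nestings : List (Edge N) → ℕ
  crossings es = count crossing? (cartesianProduct es es)
  nestings  es = count nesting? (cartesianProduct es es)

module _ {v b : Fin N} {L} pre {suf} {es}
  (sc : Scan (v ∷ L) (pre ++ b ∷ suf)) (c : IsCompletion L (pre ++ suf) es) where
  open IsCompletion c
  open Scan sc

  private
    pre<b : All (_< b) pre
    pre<b = All.map All.head (AllPairs-++⁻ pre pending-↑ .proj₂ .proj₂)
    b<suf : All (b <_) suf
    b<suf = AllPairs.head (AllPairs-++⁻ pre pending-↑ .proj₂ .proj₁)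
    v<P : All (v <_) (pre ++ b ∷ suf)
    v<P = All.head remaining<pending
    L<v : All (_< v) L
    L<v = AllPairs.head remaining-↓
    v<b : v < b
    v<b = All.head (Allₚ.++⁻ʳ pre v<P)
    es<v : All (λ e → proj₁ e < v) es
    es<v = All.map (All.lookup L<v) openers

    count-matched : {Q : Pred (Fin N) r} (Q? : Decidable Q) →
      count Q? (vertices es) ≡ count Q? L +ℕ (count Q? pre +ℕ count Q? suf)
    count-matched Q? = ≡.trans (count-↭ Q? matched)
      (≡.trans (count-++ Q? L _) (≡.cong (count Q? L +ℕ_) (count-++ Q? pre suf)))

  -- Every other edge opens before v, so it crosses (v , b) exactly when its closer lies strictly
  -- between v and b. Among the vertices of L, `pre` and `suf`, those of `pre` are the ones in this
  -- range.
  crossings-∷ : crossings ((v , b) ∷ es) ≡ length pre +ℕ crossings es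
  crossings-∷ = begin
    crossings ((v , b) ∷ es)
      ≡⟨ count-product-∷ crossing?
           ((λ (v<v , _) → <-irrefl ≡.refl v<v) ∷ All.map (λ a<v (v<a , _) → <-asym v<a a<v) es<v) ⟩
    count (crossing? ∘ (_, (v , b))) es +ℕ crossings es
      ≡⟨ ≡.cong (_+ℕ crossings es) (≡.trans
        (count-vertices (crossing? ∘ (_, (v , b))) Q?
          (All.map (λ a<v → (λ (v<a , _) → <-asym v<a a<v) , proj₂ , (a<v ,_)) es<v))
        (count-matched Q?)) ⟩
    count Q? L +ℕ (count Q? pre +ℕ count Q? suf) +ℕ crossings es
      ≡⟨ ≡.cong (_+ℕ crossings es) (≡.cong₂ _+ℕ_
        (count-none Q? (All.map (λ u<v (v<u , _) → <-asym v<u u<v) L<v))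
        (≡.cong₂ _+ℕ_ (count-all Q? (All.zip (Allₚ.++⁻ˡ pre v<P , pre<b)))
          (count-none Q? (All.map (λ b<u (_ , u<b) → <-asym b<u u<b) b<suf)))) ⟩
    length pre +ℕ 0 +ℕ crossings es
      ≡⟨ ≡.cong (_+ℕ crossings es) (ℕₚ.+-identityʳ (length pre)) ⟩
    length pre +ℕ crossings es ∎
    where
    open ≡.≡-Reasoning
    Q? : Decidable (λ u → v < u × u < b)
    Q? u = (v <? u) ×-dec (u <? b)

  -- An edge that opens before v encloses (v , b) exactly when its closer lies beyond b, and these
  -- closers form `suf`.
  nestings-∷ : nestings ((v , b) ∷ es) ≡ length suf +ℕ nestings es
  nestings-∷ = begin
    nestings ((v , b) ∷ es)
      ≡⟨ count-product-∷ nesting?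
           ((λ (v<v , _) → <-irrefl ≡.refl v<v) ∷ All.map (λ a<v (v<a , _) → <-asym v<a a<v) es<v) ⟩
    count (nesting? ∘ (_, (v , b))) es +ℕ nestings es
      ≡⟨ ≡.cong (_+ℕ nestings es) (≡.trans
        (count-vertices (nesting? ∘ (_, (v , b))) (b <?_) (All.map (λ a<v →
          (λ b<a → <-asym (<-trans a<v v<b) b<a) , (λ (_ , _ , b<d) → b<d) , (λ b<d → a<v , v<b , b<d)) es<v))
        (count-matched (b <?_))) ⟩
    count (b <?_) L +ℕ (count (b <?_) pre +ℕ count (b <?_) suf) +ℕ nestings es
      ≡⟨ ≡.cong (_+ℕ nestings es) (≡.cong₂ _+ℕ_
        (count-none (b <?_) (All.map (λ u<v → <-asym (<-trans u<v v<b)) L<v))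
        (≡.cong₂ _+ℕ_ (count-none (b <?_) (All.map <-asym pre<b)) (count-all (b <?_) b<suf))) ⟩
    length suf +ℕ nestings es ∎
    where open ≡.≡-Reasoning

-- Sums and products over lists

module Fold {c ℓ} (M : CommutativeMonoid c ℓ) where
  open CommutativeMonoid M
  open import Relation.Binary.Reasoning.Setoid setoid

  fold : (A → Carrier) → List A → Carrier
  fold f xs = foldr _∙_ ε (map f xs)

  fold-↭ : ∀ (f : A → Carrier) {xs ys} → xs ↭ ys → fold f xs ≈ fold f ys
  fold-↭ f xs↭ys = ↭ₛ.foldr-commMonoid setoid isCommutativeMonoid
    (↭ₛ.map⁺ (≡.setoid _) setoid (λ { ≡.refl → refl }) (↭⇒↭ₛ xs↭ys))

  fold-cong : ∀ {f g : A → Carrier} xs → (∀ {x} → x ∈ xs → f x ≈ g x) → fold f xs ≈ fold g xs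
  fold-cong []       f≈g = refl
  fold-cong (x ∷ xs) f≈g = ∙-cong (f≈g (here ≡.refl)) (fold-cong xs (f≈g ∘ there))

  fold-++ : ∀ (f : A → Carrier) xs ys → fold f (xs ++ ys) ≈ fold f xs ∙ fold f ys
  fold-++ f []       ys = sym (identityˡ _)
  fold-++ f (x ∷ xs) ys = trans (∙-congˡ (fold-++ f xs ys)) (sym (assoc _ _ _))

  fold-map : ∀ (f : B → Carrier) (g : A → B) xs → fold f (map g xs) ≡ fold (f ∘ g) xs
  fold-map f g xs = ≡.cong (foldr _∙_ ε) (≡.sym (map-∘ xs))

  fold-concatMap : ∀ (f : B → Carrier) (g : A → List B) xs → fold f (concatMap g xs) ≈ fold (fold f ∘ g) xs
  fold-concatMap f g []       = refl
  fold-concatMap f g (x ∷ xs) = trans (fold-++ f (g x) (concatMap g xs)) (∙-congˡ (fold-concatMap f g xs))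

  fold-ε : ∀ {f : A → Carrier} xs → (∀ {x} → x ∈ xs → f x ≈ ε) → fold f xs ≈ ε
  fold-ε []       f≈ε = refl
  fold-ε (x ∷ xs) f≈ε = trans (∙-cong (f≈ε (here ≡.refl)) (fold-ε xs (f≈ε ∘ there))) (identityˡ ε)

-- The scan recursion and its closed form

module _ {c ℓ} (R : CommutativeRing c ℓ) where
  open CommutativeRing R
  open Exp semiring using () renaming (_^_ to _^ᴿ_)
  open RingProperties ring using (-1*x≈-x)
  open Fold +-commutativeMonoid
  open import Relation.Binary.Reasoning.Setoid setoid

  fold-distribˡ : ∀ r (f : A → Carrier) xs → fold (λ x → r * f x) xs ≈ r * fold f xs
  fold-distribˡ r f []       = sym (zeroʳ r)
  fold-distribˡ r f (x ∷ xs) = trans (+-congˡ (fold-distribˡ r f xs)) (sym (distribˡ r _ _))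

  module _ {V : Set a} (x : V → Carrier) (q : Carrier) where

    -- The factor that an edge from v to b brings to the weight of a matching: `pre` counts its new
    -- crossings and `suf` its new nestings.
    closing : V → Split V → Carrier
    closing v (pre , b , suf) = (- 1#) ^ᴿ length pre * q ^ᴿ (length pre +ℕ length suf) * (x v - x b)

    -- An arbitrary f stands for the sum over the vertices still to come, so that the steps below
    -- depend only on the shape of f. V carries no order, because the places in P already determine
    -- all signs and powers of q.
    scanStep : (List V → Carrier) → V → List V → Carrier
    scanStep f v P = f (v ∷ P) + fold (λ s → closing v s * f (unpicked s)) (splits P)

    scanSum : List V → List V → Carrier
    scanSum []      []      = 1#
    scanSum []      (_ ∷ _) = 0#
    scanSum (v ∷ L)         = scanStep (scanSum L) v

    scanStep-zero : ∀ f v P → f (v ∷ P) ≈ 0# → (∀ P′ → suc (length P′) ≡ length P → f P′ ≈ 0#) →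
      scanStep f v P ≈ 0#
    scanStep-zero f v P f[v∷P] f[P′] = trans (+-cong f[v∷P] (fold-ε (splits P) λ s∈ →
      trans (*-congˡ (f[P′] _ (length-unpicked s∈))) (zeroʳ _))) (+-identityˡ 0#)
      where
      length-unpicked : ∀ {s} → s ∈ splits P → suc (length (unpicked s)) ≡ length P
      length-unpicked {pre , b , suf} s∈ rewrite ∈-splits⁻ s∈ =
        ≡.trans (≡.cong suc (length-++ pre)) (≡.trans (≡.sym (ℕₚ.+-suc _ _)) (≡.sym (length-++ pre)))

    -- The shapes of scanSum L, as a function of the pending closers, for L of even
    -- length and for L of odd length with head v.
    record EvenForm (f : List V → Carrier) (α β : Carrier) : Set (c ⊔ ℓ ⊔ a) where
      field
        none : f [] ≈ α
        one  : ∀ a → f (a ∷ []) ≈ 0#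
        two  : ∀ a b → f (a ∷ b ∷ []) ≈ β * (x a - x b)
        many : ∀ P → 3 ≤ length P → f P ≈ 0#

    record OddForm (f : List V → Carrier) (γ : Carrier) (v : V) : Set (c ⊔ ℓ ⊔ a) where
      field
        none : f [] ≈ 0#
        one  : ∀ a → f (a ∷ []) ≈ γ * (x v - x a)
        many : ∀ P → 2 ≤ length P → f P ≈ 0#

    private
      open Solver commutativeSemiring using (solve; con; _:=_; _:+_; _:*_)

      -- The solver is for semirings.  It treats −1 as a variable m, and the
      -- identities hold up to a multiple of 1 + m, which vanish removes.
      m : Carrier
      m = - 1#

      sub : ∀ y z → y - z ≈ y + m * z
      sub y z = +-congˡ (sym (-1*x≈-x z))

      vanish : ∀ y z → y + (1# + m) * z ≈ y
      vanish y z = trans (+-congˡ (trans (*-congʳ (-‿inverseʳ 1#)) (zeroˡ z))) (+-identityʳ y)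

    -- The three-term Plücker relation for the 2 × 2 minors of the vectors (1, v), (1, a), (1, b),
    -- (1, c). It is what makes the sum vanish at three pending closers.
    plücker : ∀ v a b c → (v - a) * (b - c) + (m * ((v - b) * (a - c)) + (v - c) * (a - b)) ≈ 0#
    plücker v a b c = begin
      (v - a) * (b - c) + (m * ((v - b) * (a - c)) + (v - c) * (a - b))
        ≈⟨ +-cong (*-cong (sub v a) (sub b c))
             (+-cong (*-congˡ (*-cong (sub v b) (sub a c))) (*-cong (sub v c) (sub a b))) ⟩
      (v + m * a) * (b + m * c) + (m * ((v + m * b) * (a + m * c)) + (v + m * c) * (a + m * b))
        -- Each of the six monomials occurs twice, with coefficients that differ by a factor m, so 1
        -- + m can be taken out.
        ≈⟨ solve 5 (λ v a b c m →
             (v :+ m :* a) :* (b :+ m :* c)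
             :+ (m :* ((v :+ m :* b) :* (a :+ m :* c)) :+ (v :+ m :* c) :* (a :+ m :* b))
             := con 0 :+ (con 1 :+ m) :* (v :* b :+ m :* (v :* c) :+ m :* (a :* b) :+ m :* (a :* c)
                :+ v :* a :+ m :* m :* (b :* c)))
             refl v a b c m ⟩
      0# + (1# + m) * (v * b + m * (v * c) + m * (a * b) + m * (a * c) + v * a + m * m * (b * c))
        ≈⟨ vanish 0# _ ⟩
      0# ∎

    -- Again a Plücker relation, now used to separate the scanned v and w from the pending a and b.
    exchange : ∀ v w a b → (v - a) * (w - b) + m * ((v - b) * (w - a)) ≈ m * ((w - v) * (a - b))
    exchange v w a b = begin
      (v - a) * (w - b) + m * ((v - b) * (w - a))
        ≈⟨ +-cong (*-cong (sub v a) (sub w b)) (*-congˡ (*-cong (sub v b) (sub w a))) ⟩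
      (v + m * a) * (w + m * b) + m * ((v + m * b) * (w + m * a))
        -- The product v b has coefficient m on one side and m cubed on the other; multiples of 1 +
        -- m by m m and by m make the two agree.
        ≈⟨ vanish _ _ ⟨
      (v + m * a) * (w + m * b) + m * ((v + m * b) * (w + m * a)) + (1# + m) * (m * m * (v * b))
        ≈⟨ solve 5 (λ v w a b m →
             (v :+ m :* a) :* (w :+ m :* b) :+ m :* ((v :+ m :* b) :* (w :+ m :* a))
             :+ (con 1 :+ m) :* (m :* m :* (v :* b))
             := m :* ((w :+ m :* v) :* (a :+ m :* b))
             :+ (con 1 :+ m) :* (v :* w :+ m :* m :* (a :* b) :+ m :* (v :* b)))
             refl v w a b m ⟩
      m * ((w + m * v) * (a + m * b)) + (1# + m) * (v * w + m * m * (a * b) + m * (v * b))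
        ≈⟨ vanish _ _ ⟩
      m * ((w + m * v) * (a + m * b))
        ≈⟨ *-congˡ (*-cong (sub w v) (sub a b)) ⟨
      m * ((w - v) * (a - b)) ∎

    -- With one pending closer a, leaving v pending gives β and joining v to a gives α, each times
    -- x_v - x_a; hence the coefficient α + β.
    odd-step : ∀ {f α β} v → EvenForm f α β → OddForm (scanStep f v) (α + β) v
    odd-step {f} {α} {β} v F = record
      { none = trans (+-identityʳ _) (F.one v)
      ; one  = λ a → begin
          f (v ∷ a ∷ []) + (1# * 1# * (x v - x a) * f [] + 0#)
            ≈⟨ +-cong (F.two v a) (+-congʳ (*-congˡ F.none)) ⟩
          β * (x v - x a) + (1# * 1# * (x v - x a) * α + 0#)
            ≈⟨ solve 3 (λ d α β → β :* d :+ (con 1 :* con 1 :* d :* α :+ con 0) := (α :+ β) :* d)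
                 refl (x v - x a) α β ⟩
          (α + β) * (x v - x a) ∎
      ; many = many }
      where
      module F = EvenForm F
      many : ∀ P → 2 ≤ length P → scanStep f v P ≈ 0#
      many (_ ∷ []) (s≤s ())
      many P@(_ ∷ _ ∷ []) _ = scanStep-zero f v P (F.many _ ℕₚ.≤-refl) λ { (y ∷ []) _ → F.one y }
      -- The one length at which the terms do not vanish separately: picking one of three closers
      -- leaves two, where f may be nonzero.
      many (a ∷ b ∷ c ∷ []) _ = begin
        f (v ∷ a ∷ b ∷ c ∷ []) + (1# * (q * (q * 1#)) * (x v - x a) * f (b ∷ c ∷ [])
          + (m * 1# * (q * (q * 1#)) * (x v - x b) * f (a ∷ c ∷ [])
          + (m * (m * 1#) * (q * (q * 1#)) * (x v - x c) * f (a ∷ b ∷ []) + 0#)))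
          ≈⟨ +-cong (F.many _ (s≤s (s≤s (s≤s z≤n)))) (+-cong (*-congˡ (F.two b c))
               (+-cong (*-congˡ (F.two a c)) (+-congʳ (*-congˡ (F.two a b))))) ⟩
        0# + (1# * (q * (q * 1#)) * (x v - x a) * (β * (x b - x c))
          + (m * 1# * (q * (q * 1#)) * (x v - x b) * (β * (x a - x c))
          + (m * (m * 1#) * (q * (q * 1#)) * (x v - x c) * (β * (x a - x b)) + 0#)))
          -- The sign of the third term is m m, where `plücker` has 1; the added multiples of 1 + m
          -- make up for this.
          ≈⟨ vanish _ _ ⟨
        _ + (1# + m) * (q * q * β * ((x v - x c) * (x a - x b)))
          ≈⟨ solve 9 (λ m q β va bc vb ac vc ab →
               con 0 :+ (con 1 :* (q :* (q :* con 1)) :* va :* (β :* bc)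
               :+ (m :* con 1 :* (q :* (q :* con 1)) :* vb :* (β :* ac)
               :+ (m :* (m :* con 1) :* (q :* (q :* con 1)) :* vc :* (β :* ab) :+ con 0)))
               :+ (con 1 :+ m) :* (q :* q :* β :* (vc :* ab))
               := q :* q :* β :* (va :* bc :+ (m :* (vb :* ac) :+ vc :* ab))
               :+ (con 1 :+ m) :* (m :* (q :* q :* β :* (vc :* ab))))
               refl m q β (x v - x a) (x b - x c) (x v - x b) (x a - x c) (x v - x c) (x a - x b) ⟩
        _ + (1# + m) * _
          ≈⟨ vanish _ _ ⟩
        q * q * β * ((x v - x a) * (x b - x c) + (m * ((x v - x b) * (x a - x c)) + (x v - x c) * (x a - x b)))
          ≈⟨ *-congˡ (plücker (x v) (x a) (x b) (x c)) ⟩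
        q * q * β * 0# ≈⟨ zeroʳ _ ⟩
        0# ∎
      many P@(_ ∷ _ ∷ _ ∷ _ ∷ _) _ = scanStep-zero f v P (F.many _ (s≤s (s≤s (s≤s z≤n))))
        λ { P′@(_ ∷ _ ∷ _ ∷ _) _ → F.many P′ (s≤s (s≤s (s≤s z≤n))) }

    -- With two pending closers a and b, the vertices v and w must take one each. The two ways
    -- differ by the sign of a crossing, and `exchange` merges them into a multiple of x_a - x_b.
    -- The new β is therefore -q times the new α.
    even-step : ∀ {f γ w} v → OddForm f γ w →
      EvenForm (scanStep f v) (γ * (x w - x v)) (m * (q * (γ * (x w - x v))))
    even-step {f} {γ} {w} v F = record
      { none = trans (+-identityʳ _) (F.one v)
      ; one  = λ a → scanStep-zero f v (a ∷ []) (F.many _ ℕₚ.≤-refl) λ { [] _ → F.none }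
      ; two  = λ a b → begin
          f (v ∷ a ∷ b ∷ []) + (1# * (q * 1#) * (x v - x a) * f (b ∷ [])
            + (m * 1# * (q * 1#) * (x v - x b) * f (a ∷ []) + 0#))
            ≈⟨ +-cong (F.many _ (s≤s (s≤s z≤n))) (+-cong (*-congˡ (F.one b)) (+-congʳ (*-congˡ (F.one a)))) ⟩
          0# + (1# * (q * 1#) * (x v - x a) * (γ * (x w - x b))
            + (m * 1# * (q * 1#) * (x v - x b) * (γ * (x w - x a)) + 0#))
            ≈⟨ solve 7 (λ m q γ va wb vb wa →
                 con 0 :+ (con 1 :* (q :* con 1) :* va :* (γ :* wb)
                 :+ (m :* con 1 :* (q :* con 1) :* vb :* (γ :* wa) :+ con 0))
                 := q :* γ :* (va :* wb :+ m :* (vb :* wa)))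
                 refl m q γ (x v - x a) (x w - x b) (x v - x b) (x w - x a) ⟩
          q * γ * ((x v - x a) * (x w - x b) + m * ((x v - x b) * (x w - x a)))
            ≈⟨ *-congˡ (exchange (x v) (x w) (x a) (x b)) ⟩
          q * γ * (m * ((x w - x v) * (x a - x b)))
            ≈⟨ solve 5 (λ q γ m wv ab → q :* γ :* (m :* (wv :* ab)) := m :* (q :* (γ :* wv)) :* ab)
                 refl q γ m (x w - x v) (x a - x b) ⟩
          m * (q * (γ * (x w - x v))) * (x a - x b) ∎
      ; many = many }
      where
      module F = OddForm F
      many : ∀ P → 3 ≤ length P → scanStep f v P ≈ 0#
      many (_ ∷ [])     (s≤s ())
      many (_ ∷ _ ∷ []) (s≤s (s≤s ()))
      many P@(_ ∷ _ ∷ _ ∷ _) _ = scanStep-zero f v P (F.many _ (s≤s (s≤s z≤n)))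
        λ { P′@(_ ∷ _ ∷ _) _ → F.many P′ (s≤s (s≤s z≤n)) }

    scanSum-[] : EvenForm (scanSum []) 1# 0#
    scanSum-[] = record
      { none = refl
      ; one  = λ _ → refl
      ; two  = λ _ _ → sym (zeroˡ _)
      ; many = λ { (_ ∷ _) _ → refl } }

    gaps : List (V × V) → Carrier
    gaps []             = 1#
    gaps ((v , w) ∷ ps) = (x w - x v) * gaps ps

    record Reduced (ps : List (V × V)) : Set (c ⊔ ℓ ⊔ a) where
      field
        α β   : Carrier
        form  : EvenForm (scanSum (vertices ps)) α β
        total : α + β ≈ (1# - q) ^ᴿ length ps * gaps ps

    private
      combine-total : ∀ γ d y g → γ ≈ y * g → γ * d + m * (q * (γ * d)) ≈ (1# - q) * y * (d * g)
      combine-total γ d y g γ≈ = begin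
        γ * d + m * (q * (γ * d))
          ≈⟨ solve 4 (λ γ d m q → γ :* d :+ m :* (q :* (γ :* d)) := (con 1 :+ m :* q) :* (γ :* d))
               refl γ d m q ⟩
        (1# + m * q) * (γ * d)
          ≈⟨ *-cong (sym (sub 1# q)) (*-congʳ γ≈) ⟩
        (1# - q) * (y * g * d)
          ≈⟨ solve 4 (λ r y g d → r :* (y :* g :* d) := r :* y :* (d :* g)) refl (1# - q) y g d ⟩
        (1# - q) * y * (d * g) ∎

    reduce : ∀ ps → Reduced ps
    reduce [] = record { form = scanSum-[] ; total = trans (+-identityʳ 1#) (sym (*-identityˡ 1#)) }
    reduce ((v , w) ∷ ps) = record
      { form  = even-step v (odd-step w form)
      ; total = combine-total _ _ _ _ total }
      where open Reduced (reduce ps)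

    -- The front pair is treated apart because the final value is α and not α + β: this α is the
    -- preceding α + β times one more gap, without a further factor 1 - q.
    scanSum-vertices : ∀ v w ps →
      scanSum (vertices ((v , w) ∷ ps)) [] ≈ (1# - q) ^ᴿ length ps * gaps ((v , w) ∷ ps)
    scanSum-vertices v w ps = begin
      scanSum (vertices ((v , w) ∷ ps)) []          ≈⟨ EvenForm.none (even-step v (odd-step w form)) ⟩
      (α + β) * (x w - x v)                         ≈⟨ *-congʳ total ⟩
      (1# - q) ^ᴿ length ps * gaps ps * (x w - x v) ≈⟨ trans (*-assoc _ _ _) (*-congˡ (*-comm _ _)) ⟩
      (1# - q) ^ᴿ length ps * ((x w - x v) * gaps ps) ∎
      where open Reduced (reduce ps)

-- The vertices in consecutive pairs, from the last pair to the first

decreasing-vertices : {ps : List (Edge N)} → All (λ (v , w) → w < v) ps →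
  AllPairs (λ e f → proj₁ f < proj₂ e × proj₂ f < proj₂ e) ps → AllPairs (flip _<_) (vertices ps)
decreasing-vertices [] [] = []
decreasing-vertices {N} {(v , w) ∷ ps} (w<v ∷ ps↓) (ps<w ∷ ps<) =
  (w<v ∷ All.map (λ u<w → ℕₚ.<-trans u<w w<v) vertices<w) ∷ vertices<w ∷ decreasing-vertices ps↓ ps<
  where
  vertices<w : All (_< w) (vertices ps)
  vertices<w = All.tabulate λ k∈ →
    let e , e∈ , k∈e = find (∈-vertices⁻ ps k∈) in endpoint (All.lookup ps<w e∈) k∈e
    where
    endpoint : ∀ {k e} → proj₁ e < w × proj₂ e < w → k ∈ₑ e → k < w
    endpoint (a<w , _) (inj₁ ≡.refl) = a<w
    endpoint (_ , b<w) (inj₂ ≡.refl) = b<w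

opposite-< : ∀ {n} {i j : Fin n} → i < j → opposite j < opposite i
opposite-< {n} {i} {j} i<j rewrite opposite-prop i | opposite-prop j = ℕₚ.∸-monoʳ-< (s≤s i<j) (toℕ<n j)

module _ (n : ℕ) where

  -- With indices from 0, the pair of 2i - 1 and 2i becomes `combine i 0F` and `combine i 1F`.
  -- Putting the larger vertex first and reversing i by `opposite` makes the concatenated list
  -- decreasing.
  block : Fin n → Edge (n *ℕ 2)
  block i = combine (opposite i) 1F , combine (opposite i) 0F

  blocks : List (Edge (n *ℕ 2))
  blocks = tabulate block

  blocks-decreasing : AllPairs (flip _<_) (vertices blocks)
  blocks-decreasing = decreasing-vertices
    (Allₚ.tabulate⁺ {f = block} λ i →
      ≡.subst₂ ℕ._<_ (≡.sym (toℕ-combine (opposite i) 0F)) (≡.sym (toℕ-combine (opposite i) 1F))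
        (ℕₚ.+-monoʳ-< (2 *ℕ toℕ (opposite i)) ℕ.z<s))
    (AllPairsₚ.tabulate⁺-< {f = block} λ {i} {j} i<j →
      combine-monoˡ-< 1F 0F (opposite-< i<j) ,
      combine-monoˡ-< {i = opposite j} {opposite i} 0F 0F (opposite-< i<j))

  ∈-blocks : ∀ k → k ∈ vertices blocks
  ∈-blocks k with combine-surjective {n} {2} k
  ... | i , j , ≡.refl = ∈-vertices⁺ (lose (∈-tabulate⁺ (opposite i)) (endpoint j))
    where
    endpoint : ∀ j → combine i j ∈ₑ block (opposite i)
    endpoint 0F = inj₂ (≡.cong (λ i → combine i 0F) (≡.sym (opposite-involutive i)))
    endpoint 1F = inj₁ (≡.cong (λ i → combine i 1F) (≡.sym (opposite-involutive i)))

  length-blocks : length (vertices blocks) ≡ n *ℕ 2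
  length-blocks = ≡.trans (length-vertices blocks) (≡.cong (_*ℕ 2) (length-tabulate block))

-- The Pfaffian as a scan sum

module _ {c ℓ} (R : CommutativeRing c ℓ) where
  open CommutativeRing R
  open Exp semiring using (^-homo-*; ^-congʳ) renaming (_^_ to _^ᴿ_)
  open Fold +-commutativeMonoid
  private module Π = Fold *-commutativeMonoid
  open import Relation.Binary.Reasoning.Setoid setoid

  weight : (Fin N → Fin N → Carrier) → Carrier → List (Edge N) → Carrier
  weight A q es = (- 1#) ^ᴿ crossings es * q ^ᴿ (crossings es +ℕ nestings es)
    * Π.fold (λ (a , b) → A a b) es

  ∏-lookup : ∀ {A : Set} {n} (f : A → Carrier) (v : Vec A n) →
    ∏ R (λ i → f (lookup v i)) ≡ Π.fold f (toList v)
  ∏-lookup f []      = ≡.refl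
  ∏-lookup f (a ∷ v) = ≡.cong (f a *_) (∏-lookup f v)

  -- Reversing the list of edges permutes the ordered pairs of edges and the factors of the product,
  -- so neither the counts nor the product change.
  weight-toDecreasing : ∀ {n} A q (m : Vec (Edge N) n) →
    (- 1#) ^ᴿ cross m * q ^ᴿ (cross m +ℕ nest m) * ∏ R (λ i → let (a , b) = lookup m i in A a b)
      ≈ weight A q (toDecreasing m)
  weight-toDecreasing A q m = *-cong
    (*-cong (^-congʳ (- 1#) same-crossings) (^-congʳ q (≡.cong₂ _+ℕ_ same-crossings same-nestings)))
    (trans (reflexive (∏-lookup (λ (a , b) → A a b) m)) (sym (Π.fold-↭ _ (↭-reverse (toList m)))))
    where
    same-pairs = cartesianProduct-↭ (↭-reverse (toList m)) (↭-reverse (toList m))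
    same-crossings : cross m ≡ crossings (toDecreasing m)
    same-crossings = ≡.sym (count-↭ crossing? same-pairs)
    same-nestings : nest m ≡ nestings (toDecreasing m)
    same-nestings = ≡.sym (count-↭ nesting? same-pairs)

  Pf-completions : ∀ {n L} → AllPairs (flip _<_) L → (∀ k → k ∈ L) → length L ≡ n *ℕ 2 →
    ∀ q A → Pf R q n A ≈ fold (weight A q) (completions L [])
  Pf-completions {n} {L} L↓ ∈L |L| q A = begin
    Pf R q n A
      ≈⟨ fold-cong (perfectMatchings n) (λ {m} _ → weight-toDecreasing A q m) ⟩
    fold (weight A q ∘ toDecreasing) (perfectMatchings n)
      ≡⟨ fold-map (weight A q) toDecreasing (perfectMatchings n) ⟨
    fold (weight A q) (map toDecreasing (perfectMatchings n))
      ≈⟨ fold-↭ _ (perfectMatchings-↭ {n = n} L↓ ∈L |L|) ⟩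
    fold (weight A q) (completions L []) ∎

  module _ {N} (x : Fin N → Carrier) (q : Carrier) where

    private
      w : List (Edge N) → Carrier
      w = weight (λ a b → x a - x b) q
      open Solver commutativeSemiring using (solve; _:=_; _:*_)

    -- The crossings and nestings added by the new edge depend only on its place in P and not on
    -- `es`, so its factor can be taken out of the sum over all `es`.
    weight-∷ : ∀ {v L P s es} → Scan (v ∷ L) P → s ∈ splits P → es ∈ completions L (unpicked s) →
      w ((v , picked s) ∷ es) ≈ closing R x q v s * w es
    weight-∷ {v} {L} {P} {pre , b , suf} {es} sc s∈ es∈ with ≡.refl ← ∈-splits⁻ s∈ = begin
      (- 1#) ^ᴿ crossings es⁺ * q ^ᴿ (crossings es⁺ +ℕ nestings es⁺) * ((x v - x b) * π)
        ≈⟨ *-congʳ (*-cong (^-congʳ (- 1#) c≡) (^-congʳ q (≡.trans (≡.cong₂ _+ℕ_ c≡ n≡)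
             (interchange ℕₚ.+-commutativeSemigroup (length pre) _ _ _)))) ⟩
      (- 1#) ^ᴿ (length pre +ℕ crossings es) * q ^ᴿ (others +ℕ pairs) * ((x v - x b) * π)
        ≈⟨ *-congʳ (*-cong (^-homo-* (- 1#) (length pre) _) (^-homo-* q others _)) ⟩
      (- 1#) ^ᴿ length pre * (- 1#) ^ᴿ crossings es * (q ^ᴿ others * q ^ᴿ pairs) * ((x v - x b) * π)
        ≈⟨ solve 6 (λ s t a b d π → s :* t :* (a :* b) :* (d :* π) := s :* a :* d :* (t :* b :* π)) refl
             ((- 1#) ^ᴿ length pre) ((- 1#) ^ᴿ crossings es) (q ^ᴿ others) (q ^ᴿ pairs) (x v - x b) π ⟩
      closing R x q v (pre , b , suf) * w es ∎
      where
      es⁺   = (v , b) ∷ es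
      π     = Π.fold (λ (a , b) → x a - x b) es
      others = length pre +ℕ length suf
      pairs = crossings es +ℕ nestings es
      completion = completions-sound (Scan-unpick pre sc) es∈
      c≡  = crossings-∷ pre sc completion
      n≡  = nestings-∷ pre sc completion

    -- `scanSum` follows the recursion of `completions` branch by branch; distributivity takes the
    -- factor of the new edge out of each branch.
    fold-completions : ∀ {L P} → Scan L P → fold w (completions L P) ≈ scanSum R x q L P
    fold-completions {[]}    {[]}    sc = trans (+-identityʳ _) (trans (*-identityʳ _) (*-identityʳ _))
    fold-completions {[]}    {_ ∷ _} sc = refl
    fold-completions {v ∷ L} {P}     sc = begin
      fold w (completions L (v ∷ P) ++ concatMap branch (splits P))
        ≈⟨ fold-++ w (completions L (v ∷ P)) _ ⟩
      fold w (completions L (v ∷ P)) + fold w (concatMap branch (splits P))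
        ≈⟨ +-cong (fold-completions (Scan-pend sc))
             (trans (fold-concatMap w branch (splits P)) (fold-cong (splits P) fold-branch)) ⟩
      scanSum R x q (v ∷ L) P ∎
      where
      branch : Split (Fin N) → List (List (Edge N))
      branch s = map ((v , picked s) ∷_) (completions L (unpicked s))
      fold-branch : ∀ {s} → s ∈ splits P → fold w (branch s) ≈ closing R x q v s * scanSum R x q L (unpicked s)
      fold-branch {s@(pre , b , suf)} s∈ = begin
        fold w (branch s)
          ≡⟨ fold-map w ((v , b) ∷_) (completions L (pre ++ suf)) ⟩
        fold (w ∘ ((v , b) ∷_)) (completions L (pre ++ suf))
          ≈⟨ fold-cong _ (weight-∷ sc s∈) ⟩
        fold (λ es → closing R x q v s * w es) (completions L (pre ++ suf))
          ≈⟨ fold-distribˡ R (closing R x q v s) w (completions L (pre ++ suf)) ⟩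
        closing R x q v s * fold w (completions L (pre ++ suf))
          ≈⟨ *-congˡ (fold-completions (Scan-unpick′ s∈)) ⟩
        closing R x q v s * scanSum R x q L (pre ++ suf) ∎
        where
        Scan-unpick′ : (pre , b , suf) ∈ splits P → Scan L (pre ++ suf)
        Scan-unpick′ s∈ with ≡.refl ← ∈-splits⁻ s∈ = Scan-unpick pre sc

  gaps-tabulate : ∀ {n} {V : Set} (x : V → Carrier) q (f : Fin n → V × V) →
    gaps R x q (tabulate f) ≡ ∏ R (λ i → x (proj₂ (f i)) - x (proj₁ (f i)))
  gaps-tabulate {zero}  x q f = ≡.refl
  gaps-tabulate {suc n} x q f = ≡.cong (_ *_) (gaps-tabulate x q (f ∘ suc))

corollary7 : {c ℓ : Level} (R : CommutativeRing c ℓ) →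
  let open CommutativeRing R
      _^ᴿ_ = _^_ semiring in
  (n : ℕ) .{{_ : NonZero n}} (q : Carrier) (x : Fin (n *ℕ 2) → Carrier) →
  Pf R q n (λ i j → x i - x j)
    ≈ ((1# - q) ^ᴿ (n ∸ 1)) * ∏ R (λ (i : Fin n) → x (combine i 0F) - x (combine i 1F))
corollary7 R n@(suc n-1) q x = begin
  Pf R q n (λ i j → x i - x j)
    ≈⟨ Pf-completions R {n} (blocks-decreasing n) (∈-blocks n) (length-blocks n) q (λ i j → x i - x j) ⟩
  fold (weight R (λ i j → x i - x j) q) (completions (vertices (blocks n)) [])
    ≈⟨ fold-completions R x q (mkScan (blocks-decreasing n) [] (All.tabulate λ _ → [])) ⟩
  scanSum R x q (vertices (blocks n)) []
    ≈⟨ scanSum-vertices R x q _ _ later ⟩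
  (1# - q) ^ᴿ length later * gaps R x q (blocks n)
    ≈⟨ *-cong (^-congʳ (1# - q) (length-tabulate (block n ∘ suc)))
         (reflexive (gaps-tabulate R x q (block n))) ⟩
  (1# - q) ^ᴿ n-1 * ∏ R (gap ∘ opposite)
    -- The blocks run from the last pair to the first, so the product is reindexed by the reversal
    -- of `Fin n`.
    ≈⟨ *-congˡ (Sum.sum-permute *-commutativeMonoid gap Permutation.reverse) ⟨
  (1# - q) ^ᴿ n-1 * ∏ R gap ∎
  where
  open CommutativeRing R
  open Exp semiring using (^-congʳ) renaming (_^_ to _^ᴿ_)
  open Fold +-commutativeMonoid
  open import Relation.Binary.Reasoning.Setoid setoid
  gap : Fin n → Carrier
  gap i = x (combine i 0F) - x (combine i 1F)
  later : List (Edge (n *ℕ 2))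
  later = tabulate (block n ∘ suc)
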